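{- Let $r$ be a polymatroid on a finite ground set $E$ and let $(L,G)$ be its generator enriched lattice of flats. The minors of $(L,G)$ are in bijection with the parallel closed pairs of $r$.
   Context: A polymatroid on $E$ is a function $r$ from subsets of $E$ to $\mathbb{R}_{\ge0}$ with $r(\emptyset)=0$, monotone under inclusion, and $r(X\cap Y)+r(X\cup Y)\le r(X)+r(Y)$. Closure: $\overline{X}=\{e\in E: r(X)=r(X\cup\{e\})\}$; flats are the sets $\overline X$, forming a lattice $L$ under inclusion (meet $\cap$, join $\overline{X\cup Y}$). The generator enriched lattice of flats is $(L,G)$ with $G=\{\overline{\{e\}}: r(\{e\})\ne0\}$. Minors of polymatroids: $r\setminus X$ is the restriction of $r$ to subsets of $E\setminus X$; $(r/X)(Z)=r(Z\cup X)-r(X)$ for $Z\subseteq E\setminus X$. Elements $e,f$ are parallel with respect to a polymatroid $t$ if $t(\{e,f\})=t(\{e\})=t(\{f\})$. A parallel closed pair of $r$ is a pair $(F,s)$ where $F\subseteq E$ is a flat of $r$ and $s$ is a polymatroid obtainable as a deletion $(r/F)\setminus Z$ ($Z\subseteq E\setminus F$) such that whenever $e\in E\setminus F$ is parallel with respect to $r/F$ to an element of the ground set of $s$, $e$ also lies in the ground set of $s$ (i.e. the ground set of $s$ is a union of parallel classes of $r/F$). A generator enriched lattice is a pair $(L,G)$ with $L$ a finite lattice and $G\subseteq L\setminus\{\widehat0\}$ generating $L$ under joins. For $H\subseteq L$ and $z<h$ for all $h\in H$, $\langle H|z\rangle=(\{z\}\cup\{\bigvee_{x\in S}x:\emptyset\ne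 S\subseteq H\},H)$. For $I\subseteq G$: deletion $(L,G)\setminus I=\langle G\setminus I|\widehat0_L\rangle$; with $i_0=\bigvee I$ and $J=\{g\vee i_0:g\in G\}\setminus\{i_0\}$, contraction $(L,G)/I=\langle J|i_0\rangle$. A minor of $(L,G)$ is the result of any finite sequence of deletions and contractions. -}

module Defs where

open import Level using (0ℓ) renaming (suc to lsuc)
open import Data.Nat using (ℕ)
open import Data.Fin using (Fin)
open import Data.Fin.Subset as Sub
  using (Subset; _∪_; _∩_; ∁; ⁅_⁆; _∈_; _∉_; _⊆_)
open import Data.Product using (Σ; _×_; _,_; ∃)
open import Data.Sum using (_⊎_)
open import Data.List using (List; []; _∷_)
open import Data.List.Relation.Unary.All using (All)
import Data.List.Membership.Propositional as LMem
open import Relation.Nullary using (¬_)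
open import Relation.Binary using (Rel; Setoid; IsTotalOrder)
open import Relation.Binary.PropositionalEquality using (_≡_; _≢_)
open import Function.Bundles using (_⇔_)
open import Algebra.Structures using (IsAbelianGroup)
import Function.Properties.Equivalence as EqP
import Relation.Binary.PropositionalEquality as PE

-- Values of a polymatroid.  The paper uses ℝ; the standard library has
-- no reals, so we work over an arbitrary totally ordered abelian group
-- (ℝ being one instance).  Only +, -, 0, ≤ and = are used.

record OrderedAbGroup : Set₁ where
  infixl 6 _+_ _-_
  infix  4 _≤_
  field
    Carrier : Set
    0#      : Carrier
    _+_     : Carrier → Carrier → Carrier
    -_      : Carrier → Carrier
    _≤_     : Rel Carrier 0ℓ
    isAbelianGroup : IsAbelianGroup _≡_ _+_ 0# -_
    isTotalOrder   : IsTotalOrder _≡_ _≤_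
    +-mono-≤       : ∀ {x y} z → x ≤ y → x + z ≤ y + z
  _-_ : Carrier → Carrier → Carrier
  x - y = x + (- y)

module _ (V : OrderedAbGroup) where
  open OrderedAbGroup V

  record IsPolymatroid {n : ℕ} (r : Subset n → Carrier) : Set where
    field
      empty      : r Sub.⊥ ≡ 0#
      nonneg     : ∀ X → 0# ≤ r X
      monotone   : ∀ {X Y} → X ⊆ Y → r X ≤ r Y
      submodular : ∀ X Y → r (X ∩ Y) + r (X ∪ Y) ≤ r X + r Y

  module _ {n : ℕ} (r : Subset n → Carrier) where

    IsClosureOf : Subset n → Subset n → Set
    IsClosureOf X Y = ∀ e → (e ∈ Y) ⇔ (r X ≡ r (X ∪ ⁅ e ⁆))

    IsFlat : Subset n → Set
    IsFlat F = ∃ λ X → IsClosureOf X F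

    -- Generator enriched lattices whose elements are flats of r,
    -- ordered by inclusion.  A generator enriched lattice is a pair
    -- (lattice, generators) of sets of elements of L, each given as
    -- a predicate on Subset n.

    Pred : Set₁
    Pred = Subset n → Set

    record GEL : Set₁ where
      constructor gel
      field
        Lat : Pred
        Gen : Pred

    flatGEL : GEL
    flatGEL = gel IsFlat
      (λ x → Σ (Fin n) λ e → (r ⁅ e ⁆ ≢ 0#) × IsClosureOf ⁅ e ⁆ x)

    -- x is the join (least upper bound) of the finite family S in the
    -- lattice P (ordered by inclusion).  For S = [] this is the bottom.
    IsJoinIn : Pred → List (Subset n) → Subset n → Set
    IsJoinIn P S x =
      P x × All (_⊆ x) S × (∀ y → P y → All (_⊆ y) S → x ⊆ y)

    ⟨_∣_⟩in_ : Pred → Subset n → Pred → GEL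
    ⟨ H ∣ z ⟩in P = gel
      (λ x → (x ≡ z) ⊎
        (Σ (List (Subset n)) λ S → (S ≢ []) × All H S × IsJoinIn P S x))
      H

    -- Deletion  (L,G) ∖ I  for I ⊆ G  (0̂ = join of the empty family).
    deleteGEL : GEL → List (Subset n) → Subset n → GEL
    deleteGEL (gel P Gs) I bot =
      ⟨ (λ g → Gs g × ¬ (LMem._∈_ g I)) ∣ bot ⟩in P

    -- Contraction  (L,G) / I  for I ⊆ G, where i₀ = ⋁ I.
    contractGEL : GEL → Subset n → GEL
    contractGEL (gel P Gs) i₀ =
      ⟨ (λ x → (Σ (Subset n) λ g → Gs g × IsJoinIn P (g ∷ i₀ ∷ []) x)
               × x ≢ i₀) ∣ i₀ ⟩in P

    data IsMinor : GEL → Set₁ where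
      here     : IsMinor flatGEL
      delete   : ∀ {P Gs} → IsMinor (gel P Gs) →
                 (I : List (Subset n)) → All Gs I →
                 (bot : Subset n) → IsJoinIn P [] bot →
                 IsMinor (deleteGEL (gel P Gs) I bot)
      contract : ∀ {P Gs} → IsMinor (gel P Gs) →
                 (I : List (Subset n)) → All Gs I →
                 (i₀ : Subset n) → IsJoinIn P I i₀ →
                 IsMinor (contractGEL (gel P Gs) i₀)

    record Minor : Set₁ where
      constructor minor
      field
        lat     : GEL
        isMinor : IsMinor lat

    _≈M_ : Minor → Minor → Set
    minor (gel P G) _ ≈M minor (gel P' G') _ =
      (∀ x → P x ⇔ P' x) × (∀ x → G x ⇔ G' x)

    -- The contraction r / F (on subsets of E ∖ F).
    contr : Subset n → Subset n → Carrier
    contr F Z = r (Z ∪ F) - r F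

    ParallelIn/ : Subset n → Fin n → Fin n → Set
    ParallelIn/ F e f =
      (contr F (⁅ e ⁆ ∪ ⁅ f ⁆) ≡ contr F ⁅ e ⁆) × (contr F ⁅ e ⁆ ≡ contr F ⁅ f ⁆)

    -- A parallel closed pair (F , s) with s = (r/F) ∖ Z.
    record ParallelClosedPair : Set where
      field
        F       : Subset n
        flat    : IsFlat F
        Z       : Subset n
        Z⊆E∖F   : Z ⊆ ∁ F
      ground : Subset n
      ground = ∁ F ∩ ∁ Z
      -- s = (r / F) ∖ Z, defined on subsets of its ground set
      s : Subset n → Carrier
      s = contr F
      field
        closed  : ∀ e f → e ∉ F → f ∈ ground → ParallelIn/ F e f → e ∈ ground

    _≈P_ : ParallelClosedPair → ParallelClosedPair → Set
    p ≈P q = (P.F ≡ Q.F) × (P.ground ≡ Q.ground) ×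
             (∀ X → X ⊆ P.ground → P.s X ≡ Q.s X)
      where module P = ParallelClosedPair p
            module Q = ParallelClosedPair q

    MinorSetoid : Setoid (lsuc 0ℓ) 0ℓ
    MinorSetoid = record
      { Carrier = Minor
      ; _≈_ = _≈M_
      ; isEquivalence = record
        { refl  = λ { {minor (gel P G) _} → (λ x → EqP.refl) , (λ x → EqP.refl) }
        ; sym   = λ { {minor (gel P G) _} {minor (gel P' G') _} (a , b) →
                      (λ x → EqP.sym (a x)) , (λ x → EqP.sym (b x)) }
        ; trans = λ { {minor (gel P G) _} {minor (gel P' G') _} {minor (gel P'' G'') _}
                      (a , b) (c , d) →
                      (λ x → EqP.trans (a x) (c x)) , (λ x → EqP.trans (b x) (d x)) }
        }
      }

    PairSetoid : Setoid 0ℓ 0ℓ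
    PairSetoid = record
      { Carrier = ParallelClosedPair
      ; _≈_ = _≈P_
      ; isEquivalence = record
        { refl  = PE.refl , PE.refl , (λ X _ → PE.refl)
        ; sym   = λ { (a , b , h) →
                      PE.sym a , PE.sym b ,
                      (λ X s → PE.sym (h X (PE.subst (X ⊆_) (PE.sym b) s))) }
        ; trans = λ { (a , b , h) (c , d , k) →
                      PE.trans a c , PE.trans b d ,
                      (λ X s → PE.trans (h X s) (k X (PE.subst (X ⊆_) b s))) }
        }
      }

{-# OPTIONS --safe #-}

-- A minor of (L , G) is determined by its bottom F and the set K of elements
-- e ∉ F whose join F ⊔ e = cl (F ∪ {e}) is a generator: its generators are the
-- F ⊔ e with e ∈ K, and its lattice consists of the flats x ⊇ F spanned by F
-- and x ∩ K.  This description is preserved by deletion and contraction, because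
-- joins in a minor agree with joins of flats.  Two elements e, f ∉ F are parallel
-- in r / F iff F ⊔ e = F ⊔ f, so K is a union of parallel classes, and (F , K)
-- is a parallel closed pair.  Conversely, contracting F and then deleting the
-- F ⊔ e with e ∉ K yields the minor described by a given pair (F , K).

module Submission where

open import Defs
open import Algebra.Bundles using (Group)
import Algebra.Properties.Group as GroupProperties
open import Algebra.Structures using (IsAbelianGroup)
open import Data.Bool.Properties using () renaming (_≟_ to _≟ᵇ_)
open import Data.Fin using (Fin)
open import Data.Fin.Properties using (any?)
open import Data.Fin.Subset as Sub
  using (Subset; _∪_; _∩_; ∁; ⁅_⁆; _∈_; _∉_; _⊆_; ⋃)
open import Data.Fin.Subset.Properties
open import Data.List using (List; []; _∷_; map; filter; allFin)
open import Data.List.Membership.Propositional using () renaming (_∈_ to _∈ₗ_)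
open import Data.List.Membership.Propositional.Properties
  using (∈-map⁺; ∈-map⁻; ∈-filter⁺; ∈-filter⁻; ∈-allFin)
import Data.List.Membership.DecPropositional as DecMembership
open import Data.List.Relation.Unary.All as All using (All; []; _∷_)
import Data.List.Relation.Unary.All.Properties as All
open import Data.List.Relation.Unary.Any using (here; there)
open import Data.Nat using (ℕ)
open import Data.Product using (∃; _×_; _,_; proj₁; proj₂)
open import Data.Sum using (inj₁; inj₂)
open import Data.Vec using (tabulate)
open import Data.Vec.Properties using (lookup∘tabulate; []=⇒lookup; lookup⇒[]=)
  renaming (≡-dec to Vec-≡-dec)
open import Function.Base using (_∘_; id)
open import Function.Bundles using (Bijection; Equivalence; _⇔_; mk⇔)
import Function.Properties.Equivalence as ⇔
open import Relation.Binary using (DecidableEquality; IsTotalOrder)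
open import Relation.Binary.PropositionalEquality
  using (_≡_; _≢_; refl; sym; trans; cong; subst)
open import Relation.Nullary using (yes; no; ¬_; ¬?; contradiction)
open import Relation.Nullary.Decidable using (does; dec-true; _×-dec_)
open import Relation.Unary using (Decidable)

open Equivalence using (to; from)

-- Finite subsets

module _ {n : ℕ} where

  separate : {P : Fin n → Set} → Decidable P → Subset n
  separate P? = tabulate (does ∘ P?)

  module _ {P : Fin n → Set} (P? : Decidable P) where

    ∈-separate⁺ : ∀ {e} → P e → e ∈ separate P?
    ∈-separate⁺ {e} p =
      lookup⇒[]= e _ (trans (lookup∘tabulate _ e) (dec-true (P? e) p))

    ∈-separate⁻ : ∀ {e} → e ∈ separate P? → P e
    ∈-separate⁻ {e} e∈ with P? e | trans (sym (lookup∘tabulate (does ∘ P?) e)) ([]=⇒lookup e∈)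
    ... | yes p | _ = p

  elements : Subset n → List (Fin n)
  elements X = filter (_∈? X) (allFin n)

  ∈-elements⁺ : ∀ {X e} → e ∈ X → e ∈ₗ elements X
  ∈-elements⁺ {X} {e} = ∈-filter⁺ (_∈? X) (∈-allFin e)

  ∈-elements⁻ : ∀ {X e} → e ∈ₗ elements X → e ∈ X
  ∈-elements⁻ {X} = proj₂ ∘ ∈-filter⁻ (_∈? X) {xs = allFin n}

  ∪-least : ∀ {X Y Z : Subset n} → X ⊆ Z → Y ⊆ Z → X ∪ Y ⊆ Z
  ∪-least {X} {Y} X⊆Z Y⊆Z e∈ with x∈p∪q⁻ X Y e∈
  ... | inj₁ e∈X = X⊆Z e∈X
  ... | inj₂ e∈Y = Y⊆Z e∈Y

  ∪-monoˡ : ∀ {X Y : Subset n} (Z : Subset n) → X ⊆ Y → X ∪ Z ⊆ Y ∪ Z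
  ∪-monoˡ {X} {Y} Z X⊆Y = ∪-least (λ e∈ → p⊆p∪q Z (X⊆Y e∈)) (q⊆p∪q Y Z)

  singleton⊆ : ∀ {X : Subset n} {e} → e ∈ X → ⁅ e ⁆ ⊆ X
  singleton⊆ {X} {e} e∈X f∈ = subst (_∈ X) (sym (x∈⁅y⁆⇒x≡y e f∈)) e∈X

  ⋃-upper : ∀ {S : List (Subset n)} {X} → X ∈ₗ S → X ⊆ ⋃ S
  ⋃-upper {Y ∷ S} (here refl) = p⊆p∪q (⋃ S)
  ⋃-upper {Y ∷ S} (there X∈S) e∈ = q⊆p∪q Y (⋃ S) (⋃-upper X∈S e∈)

  ⋃-least : ∀ {S : List (Subset n)} {Y} → All (_⊆ Y) S → ⋃ S ⊆ Y
  ⋃-least []           e∈ = contradiction e∈ ∉⊥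
  ⋃-least (X⊆Y ∷ S⊆Y) = ∪-least X⊆Y (⋃-least S⊆Y)

  -- Adding elements one at a time lets `r-adjoin` follow the rank by induction on the list.
  adjoin : Subset n → List (Fin n) → Subset n
  adjoin X []       = X
  adjoin X (e ∷ es) = adjoin X es ∪ ⁅ e ⁆

  adjoin-base : ∀ {X} es → X ⊆ adjoin X es
  adjoin-base []       x∈ = x∈
  adjoin-base (e ∷ es) x∈ = p⊆p∪q ⁅ e ⁆ (adjoin-base es x∈)

  adjoin-elem : ∀ {X es e} → e ∈ₗ es → e ∈ adjoin X es
  adjoin-elem {X} {e ∷ es} (here refl) = q⊆p∪q (adjoin X es) ⁅ e ⁆ (x∈⁅x⁆ e)
  adjoin-elem {X} {e ∷ es} (there e∈)  = p⊆p∪q ⁅ e ⁆ (adjoin-elem e∈)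

-- Totally ordered abelian groups

module _ (V : OrderedAbGroup) where

  open OrderedAbGroup V
  private module A = IsAbelianGroup isAbelianGroup
  open IsTotalOrder isTotalOrder using (total; antisym; reflexive) renaming (trans to ≤-trans)

  group : Group _ _
  group = record { isGroup = A.isGroup }

  open GroupProperties group using (∙-cancelʳ)

  -- Totality decides equality: when x ≡ y, the calls total x y and total y x
  -- agree, so they land on the same side, which yields both inequalities.
  ≡-decidable : DecidableEquality Carrier
  ≡-decidable x y with total x y in p | total y x in q
  ... | inj₁ x≤y | inj₁ y≤x = yes (antisym x≤y y≤x)
  ... | inj₂ y≤x | inj₂ x≤y = yes (antisym x≤y y≤x)
  ... | inj₁ _   | inj₂ _   = no λ { refl → contradiction (trans (sym p) q) λ () }
  ... | inj₂ _   | inj₁ _   = no λ { refl → contradiction (trans (sym p) q) λ () }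

  +-mono² : ∀ {a b c d} → a ≤ b → c ≤ d → a + c ≤ b + d
  +-mono² {a} {b} {c} {d} a≤b c≤d =
    ≤-trans (+-mono-≤ c a≤b)
      (≤-trans (reflexive (A.comm b c)) (≤-trans (+-mono-≤ b c≤d) (reflexive (A.comm d b))))

  +-cancelˡ-≤ : ∀ x {a b} → x + a ≤ x + b → a ≤ b
  +-cancelˡ-≤ x {a} {b} h =
    ≤-trans (reflexive (undo a)) (≤-trans (+-mono-≤ (- x) h) (reflexive (sym (undo b))))
    where
    undo : ∀ c → c ≡ (x + c) + (- x)
    undo c = sym (trans (cong (_+ (- x)) (A.comm x c))
               (trans (A.assoc c x (- x))
               (trans (cong (c +_) (A.inverseʳ x)) (A.identityʳ c))))

  module _ {n : ℕ} (r : Subset n → Carrier) (isPolymatroid : IsPolymatroid V r) where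

    open IsPolymatroid isPolymatroid

    -- Closure and flats

    cl : Subset n → Subset n
    cl X = separate (λ e → ≡-decidable (r X) (r (X ∪ ⁅ e ⁆)))

    ∈cl⁺ : ∀ {X e} → r X ≡ r (X ∪ ⁅ e ⁆) → e ∈ cl X
    ∈cl⁺ {X} = ∈-separate⁺ (λ e → ≡-decidable (r X) (r (X ∪ ⁅ e ⁆)))

    ∈cl⁻ : ∀ {X e} → e ∈ cl X → r X ≡ r (X ∪ ⁅ e ⁆)
    ∈cl⁻ {X} = ∈-separate⁻ (λ e → ≡-decidable (r X) (r (X ∪ ⁅ e ⁆)))

    cl-extensive : ∀ {X} → X ⊆ cl X
    cl-extensive {X} {e} e∈X =
      ∈cl⁺ (cong r (⊆-antisym (p⊆p∪q ⁅ e ⁆) (∪-least id (singleton⊆ e∈X))))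

    -- Submodularity for `X ∪ ⁅ e ⁆` and `Y`: their intersection contains `X` and their union
    -- contains `Y ∪ ⁅ e ⁆`. Since `e` adds no rank to `X`, cancelling `r X` shows that it adds none
    -- to `Y`.
    cl-mono : ∀ {X Y} → X ⊆ Y → cl X ⊆ cl Y
    cl-mono {X} {Y} X⊆Y {e} e∈ =
      ∈cl⁺ (antisym (monotone (p⊆p∪q ⁅ e ⁆)) (+-cancelˡ-≤ (r X) bound))
      where
      X+e = X ∪ ⁅ e ⁆
      bound : r X + r (Y ∪ ⁅ e ⁆) ≤ r X + r Y
      bound =
        ≤-trans
          (+-mono² (monotone (λ x∈ → x∈p∩q⁺ (p⊆p∪q ⁅ e ⁆ x∈ , X⊆Y x∈)))
                   (monotone (∪-least (q⊆p∪q X+e Y)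
                                      (λ x∈ → p⊆p∪q Y (q⊆p∪q X ⁅ e ⁆ x∈)))))
          (≤-trans (submodular X+e Y) (reflexive (cong (_+ r Y) (sym (∈cl⁻ e∈)))))

    -- By `cl-mono` each new element still lies in the closure of the set built so far, so no step
    -- raises the rank.
    r-adjoin : ∀ {X} es → All (_∈ cl X) es → r (adjoin X es) ≡ r X
    r-adjoin []       []          = refl
    r-adjoin (e ∷ es) (e∈ ∷ es∈) =
      trans (sym (∈cl⁻ (cl-mono (adjoin-base es) e∈))) (r-adjoin es es∈)

    r-cl : ∀ X → r (cl X) ≡ r X
    r-cl X = antisym
      (≤-trans (monotone (λ e∈ → adjoin-elem (∈-elements⁺ e∈)))
               (reflexive (r-adjoin (elements (cl X)) (All.tabulate ∈-elements⁻))))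
      (monotone cl-extensive)

    Closed : Subset n → Set
    Closed X = cl X ≡ X

    -- If `e` adds no rank to `cl X`, then `r (X ∪ ⁅ e ⁆)` is at most `r (cl X)`, which is `r X` by
    -- `r-cl`.
    cl-closed : ∀ {X} → Closed (cl X)
    cl-closed {X} = ⊆-antisym
      (λ {e} e∈ → ∈cl⁺ (antisym (monotone (p⊆p∪q ⁅ e ⁆))
        (≤-trans (monotone (∪-monoˡ ⁅ e ⁆ cl-extensive))
                 (reflexive (trans (sym (∈cl⁻ e∈)) (r-cl X))))))
      cl-extensive

    cl-least : ∀ {X Y} → X ⊆ Y → Closed Y → cl X ⊆ Y
    cl-least X⊆Y Y-closed e∈ = subst (_ ∈_) Y-closed (cl-mono X⊆Y e∈)

    -- Passes from closure as a relation to the computed `cl`, so that flats become fixed points of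
    -- `cl`.
    isClosureOf⇔ : ∀ {X Y} → IsClosureOf V r X Y ⇔ (Y ≡ cl X)
    isClosureOf⇔ = mk⇔
      (λ h → ⊆-antisym (λ e∈ → ∈cl⁺ (to (h _) e∈)) (λ e∈ → from (h _) (∈cl⁻ e∈)))
      (λ { refl e → mk⇔ ∈cl⁻ ∈cl⁺ })

    isFlat⇔ : ∀ {X} → IsFlat V r X ⇔ Closed X
    isFlat⇔ {X} = mk⇔
      (λ (Y , h) → subst Closed (sym (to isClosureOf⇔ h)) cl-closed)
      (λ X-closed → X , from isClosureOf⇔ (sym X-closed))

    -- Joins of a set with an element, and parallel elements

    infixl 6 _⊔_
    _⊔_ : Subset n → Fin n → Subset n
    F ⊔ e = cl (F ∪ ⁅ e ⁆)

    ⊔-base : ∀ {F} e → F ⊆ F ⊔ e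
    ⊔-base e x∈ = cl-extensive (p⊆p∪q ⁅ e ⁆ x∈)

    ⊔-elem : ∀ F e → e ∈ F ⊔ e
    ⊔-elem F e = cl-extensive (q⊆p∪q F ⁅ e ⁆ (x∈⁅x⁆ e))

    ⊔-least : ∀ {F e Y} → F ⊆ Y → e ∈ Y → Closed Y → F ⊔ e ⊆ Y
    ⊔-least F⊆Y e∈Y = cl-least (∪-least F⊆Y (singleton⊆ e∈Y))

    contr-≡⇔ : ∀ F {X Y} → (contr V r F X ≡ contr V r F Y) ⇔ (r (X ∪ F) ≡ r (Y ∪ F))
    contr-≡⇔ F = mk⇔ (∙-cancelʳ _ _ _) (cong (_- r F))

    -- After cancelling `r F`, parallelism says that `F ∪ ⁅ e ⁆`, `F ∪ ⁅ f ⁆` and their union have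
    -- the same rank. This puts `f` in `F ⊔ e` and `e` in `F ⊔ f`; the converse uses that closing a
    -- set keeps its rank.
    parallel⇔ : ∀ {F e f} → ParallelIn/ V r F e f ⇔ (F ⊔ e ≡ F ⊔ f)
    parallel⇔ {F} {e} {f} = mk⇔ ⇒ ⇐
      where
      swap : ∀ {g} → F ∪ ⁅ g ⁆ ≡ ⁅ g ⁆ ∪ F
      swap {g} = ∪-comm F ⁅ g ⁆

      regroup : ∀ g h → (F ∪ ⁅ g ⁆) ∪ ⁅ h ⁆ ≡ (⁅ g ⁆ ∪ ⁅ h ⁆) ∪ F
      regroup g h = trans (∪-assoc F ⁅ g ⁆ ⁅ h ⁆) (∪-comm F _)

      ⇒ : ParallelIn/ V r F e f → F ⊔ e ≡ F ⊔ f
      ⇒ (p , q) = ⊆-antisym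
        (⊔-least (⊔-base f) (∈cl⁺ (trans (cong r swap) (trans (sym q′) (trans (sym p′)
          (cong r (trans (cong (_∪ F) (∪-comm ⁅ e ⁆ ⁅ f ⁆)) (sym (regroup f e)))))))) cl-closed)
        (⊔-least (⊔-base e) (∈cl⁺ (trans (cong r swap) (trans (sym p′)
          (cong r (sym (regroup e f)))))) cl-closed)
        where
        p′ = to (contr-≡⇔ F) p
        q′ = to (contr-≡⇔ F) q

      ⇐ : F ⊔ e ≡ F ⊔ f → ParallelIn/ V r F e f
      ⇐ eq = from (contr-≡⇔ F)
               (trans (cong r (sym (regroup e f)))
                 (trans (sym (∈cl⁻ (subst (f ∈_) (sym eq) (⊔-elem F f)))) (cong r swap)))
           , from (contr-≡⇔ F)
               (trans (cong r (sym swap)) (trans (sym (r-cl _))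
                 (trans (cong r eq) (trans (r-cl _) (cong r swap)))))

    -- Minors of the lattice of flats

    -- Intersecting `K` with `x` itself avoids naming a family of generators, and the bottom `F`
    -- needs no separate case.
    Spanned : Subset n → Subset n → Subset n → Set
    Spanned F K x = Closed x × F ⊆ x × x ⊆ cl (F ∪ (x ∩ K))

    -- The field `saturated` makes `K` the largest set giving these generators, so that the minor
    -- determines it.
    record Describes (F K : Subset n) (L : GEL V r) : Set where
      open GEL L
      field
        closed    : Closed F
        disjoint  : ∀ {e} → e ∈ K → e ∉ F
        saturated : ∀ {e f} → e ∉ F → f ∈ K → F ⊔ e ≡ F ⊔ f → e ∈ K
        lat       : ∀ x → Lat x ⇔ Spanned F K x
        gen       : ∀ g → Gen g ⇔ (∃ λ e → e ∈ K × g ≡ F ⊔ e)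

    spanned-bottom : ∀ {F K} → Closed F → Spanned F K F
    spanned-bottom F-closed = F-closed , id , λ e∈ → cl-extensive (p⊆p∪q _ e∈)

    span-mono : ∀ {F K x y} → x ⊆ y → cl (F ∪ (x ∩ K)) ⊆ cl (F ∪ (y ∩ K))
    span-mono {F} {K} {x} {y} x⊆y = cl-mono (∪-least (p⊆p∪q _) λ e∈ →
      let e∈x , e∈K = x∈p∩q⁻ x K e∈ in q⊆p∪q F (y ∩ K) (x∈p∩q⁺ (x⊆y e∈x , e∈K)))

    -- Each member of `S` is spanned by `F` and its own part of `K`, and that part lies in the join.
    spanned-join : ∀ {F K S} → All (Spanned F K) S → Spanned F K (cl (F ∪ ⋃ S))
    spanned-join {F} {K} {S} S-spanned =
        cl-closed
      , (λ e∈ → cl-extensive (p⊆p∪q _ e∈))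
      , cl-least (∪-least (λ e∈ → cl-extensive (p⊆p∪q _ e∈))
          (⋃-least (All.tabulate λ s∈S e∈s →
            span-mono {K = K} (λ f∈s → cl-extensive (q⊆p∪q F (⋃ S) (⋃-upper s∈S f∈s)))
              (proj₂ (proj₂ (All.lookup S-spanned s∈S)) e∈s))))
          cl-closed

    -- Deletion and contraction of a described minor

    module _ {F K : Subset n} {P G} (D : Describes F K (gel P G)) where

      open Describes D

      -- Here `y` may be any flat above `F`, not only one in `P`: the join of flats `cl (F ∪ ⋃ S)`
      -- is itself spanned, hence in `P`, and so bounds the join taken in `P`.
      join-least : ∀ {S x y} → All P S → IsJoinIn V r P S x →
                   F ⊆ y → Closed y → All (_⊆ y) S → x ⊆ y
      join-least {S} S⊆P (_ , _ , least) F⊆y y-closed S⊆y e∈x =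
        cl-least (∪-least F⊆y (⋃-least S⊆y)) y-closed
          (least _ (from (lat _) (spanned-join (All.map (to (lat _)) S⊆P)))
            (All.tabulate λ s∈S e∈s → cl-extensive (q⊆p∪q F (⋃ S) (⋃-upper s∈S e∈s))) e∈x)

      P-closed : ∀ {x} → P x → Closed x
      P-closed Px = proj₁ (to (lat _) Px)

      P-above : ∀ {x} → P x → F ⊆ x
      P-above Px = proj₁ (proj₂ (to (lat _) Px))

      P-bottom : P F
      P-bottom = from (lat _) (spanned-bottom closed)

      G⊆P : ∀ {g} → G g → P g
      G⊆P Gg with e , e∈K , refl ← to (gen _) Gg = from (lat _)
        (cl-closed , ⊔-base e , ⊔-least (λ x∈ → cl-extensive (p⊆p∪q _ x∈))
          (cl-extensive (q⊆p∪q F _ (x∈p∩q⁺ (⊔-elem F e , e∈K)))) cl-closed)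

      bottom-unique : ∀ {x} → IsJoinIn V r P [] x → x ≡ F
      bottom-unique (Px , _ , least) = ⊆-antisym (least F P-bottom []) (P-above Px)

      bottom-join : IsJoinIn V r P [] F
      bottom-join = P-bottom , [] , λ _ Py _ → P-above Py

      -- Computes the generators of a contraction: an upper bound of `i` and `F ⊔ e` is a flat
      -- containing `i` and `e`.
      join₂-⊔ : ∀ {i e} → P i → e ∈ K → IsJoinIn V r P ((F ⊔ e) ∷ i ∷ []) (i ⊔ e)
      join₂-⊔ {i} {e} Pi e∈K =
          from (lat _) (cl-closed , (λ x∈ → ⊔-base e (P-above Pi x∈)) ,
            ⊔-least (λ x∈ → span-mono {K = K} (⊔-base e) (proj₂ (proj₂ (to (lat i) Pi)) x∈))
              (cl-extensive (q⊆p∪q F _ (x∈p∩q⁺ (⊔-elem i e , e∈K)))) cl-closed)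
        , ⊔-least (λ x∈ → ⊔-base e (P-above Pi x∈)) (⊔-elem i e) cl-closed ∷ ⊔-base e ∷ []
        , λ { _ Py (F⊔e⊆y ∷ i⊆y ∷ []) → ⊔-least i⊆y (F⊔e⊆y (⊔-elem F e)) (P-closed Py) }

      join-unique : ∀ {S x y} → IsJoinIn V r P S x → IsJoinIn V r P S y → x ≡ y
      join-unique (Px , ux , lx) (Py , uy , ly) = ⊆-antisym (lx _ Py uy) (ly _ Px ux)

      -- The common core of deletion and contraction: both choose a bottom `z` in `P` and generators
      -- `z ⊔ e`, and the joins of these in `P` are exactly the flats spanned over `z`.
      describes-⟨∣⟩ : ∀ {z K′ H} → P z →
        (∀ {e} → e ∈ K′ → e ∉ z) →
        (∀ {e f} → e ∉ z → f ∈ K′ → z ⊔ e ≡ z ⊔ f → e ∈ K′) →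
        (∀ {e} → e ∈ K′ → P (z ⊔ e)) →
        (∀ g → H g ⇔ (∃ λ e → e ∈ K′ × g ≡ z ⊔ e)) →
        Describes z K′ (⟨_∣_⟩in_ V r H z P)
      describes-⟨∣⟩ {z} {K′} {H} Pz disj sat K′⊆P genH = record
        { closed = P-closed Pz ; disjoint = disj ; saturated = sat ; gen = genH
        ; lat = λ x → mk⇔ ⇒ ⇐ }
        where
        H⊆P : ∀ {g} → H g → P g
        H⊆P Hg with e , e∈K′ , refl ← to (genH _) Hg = K′⊆P e∈K′

        z⊆H : ∀ {g} → H g → z ⊆ g
        z⊆H Hg with e , _ , refl ← to (genH _) Hg = ⊔-base e

        ⇒ : ∀ {x} → GEL.Lat (⟨_∣_⟩in_ V r H z P) x → Spanned z K′ x
        ⇒ (inj₁ refl) = spanned-bottom (P-closed Pz)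
        ⇒ (inj₂ ([] , []≢[] , _)) = contradiction refl []≢[]
        ⇒ {x} (inj₂ (S@(_ ∷ _) , _ , S⊆H@(Hs ∷ _) , join@(Px , S⊆x@(s⊆x ∷ _) , _))) =
            P-closed Px , (λ e∈ → s⊆x (z⊆H Hs e∈))
          -- The bound is the span, which is not yet known to lie in `P`; this is why `join-least`
          -- allows arbitrary flats.
          , join-least (All.map H⊆P S⊆H) join
              (λ e∈ → cl-extensive (p⊆p∪q _ (P-above Pz e∈))) cl-closed
              (All.tabulate λ s∈S → below (All.lookup S⊆H s∈S) (All.lookup S⊆x s∈S))
          where
          below : ∀ {s} → H s → s ⊆ x → s ⊆ cl (z ∪ (x ∩ K′))
          below Hs s⊆x with e , e∈K′ , refl ← to (genH _) Hs =
            ⊔-least (λ f∈ → cl-extensive (p⊆p∪q _ f∈))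
              (cl-extensive (q⊆p∪q z _ (x∈p∩q⁺ (s⊆x (⊔-elem z e) , e∈K′)))) cl-closed

        ⇐ : ∀ {x} → Spanned z K′ x → GEL.Lat (⟨_∣_⟩in_ V r H z P) x
        ⇐ {x} (x-closed , z⊆x , x⊆) with nonempty? (x ∩ K′)
        -- With nothing of `K′` in `x`, the span is `cl z`, so `x` is the bottom; the other
        -- alternative requires a nonempty family.
        ... | no empty-x∩K′ = inj₁ (⊆-antisym
          (λ e∈ → cl-least (∪-least id (λ f∈ → contradiction (_ , f∈) empty-x∩K′))
                     (P-closed Pz) (x⊆ e∈))
          z⊆x)
        ... | yes (e₀ , e₀∈) = inj₂ (S , S≢[] , S⊆H , Px , S⊆x , least)
          where
          S : List (Subset n)
          S = map (z ⊔_) (elements (x ∩ K′))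

          in-S : ∀ {e} → e ∈ x ∩ K′ → (z ⊔ e) ∈ₗ S
          in-S e∈ = ∈-map⁺ (z ⊔_) (∈-elements⁺ e∈)

          S≢[] : S ≢ []
          S≢[] eq with () ← subst ((z ⊔ e₀) ∈ₗ_) eq (in-S e₀∈)

          S⊆H : All H S
          S⊆H = All.map⁺ (All.tabulate λ e∈ →
            from (genH _) (_ , proj₂ (x∈p∩q⁻ x K′ (∈-elements⁻ e∈)) , refl))

          S⊆x : All (_⊆ x) S
          S⊆x = All.map⁺ (All.tabulate λ e∈ →
            ⊔-least z⊆x (proj₁ (x∈p∩q⁻ x K′ (∈-elements⁻ e∈))) x-closed)

          within : ∀ {y} → P y → y ⊆ x → y ⊆ cl (F ∪ (x ∩ K))
          within Py y⊆x e∈ = span-mono {K = K} y⊆x (proj₂ (proj₂ (to (lat _) Py)) e∈)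

          -- Both `z` and every `z ⊔ e` with `e` in `x ∩ K′` lie in `P` and below `x`, so `F` and
          -- `x ∩ K` span them, and therefore span `x`.
          Px : P x
          Px = from (lat x)
            ( x-closed
            , (λ e∈ → z⊆x (P-above Pz e∈))
            , λ e∈ → cl-least (∪-least (within Pz z⊆x) (λ {f} f∈ →
                let f∈x , f∈K′ = x∈p∩q⁻ x K′ f∈ in
                within (K′⊆P f∈K′) (⊔-least z⊆x f∈x x-closed) (⊔-elem z f)))
                cl-closed (x⊆ e∈) )

          least : ∀ y → P y → All (_⊆ y) S → x ⊆ y
          least y Py S⊆y e∈ = cl-least
            -- The family is nonempty, so `z` lies below `y` through `z ⊔ e₀`.
            (∪-least (λ f∈ → All.lookup S⊆y (in-S e₀∈) (⊔-base e₀ f∈))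
                     (λ {f} f∈ → All.lookup S⊆y (in-S f∈) (⊔-elem z f)))
            (P-closed Py) (x⊆ e∈)

      open DecMembership (Vec-≡-dec {n = n} _≟ᵇ_) using () renaming (_∈?_ to _∈ₗ?_)

      survives? : ∀ I → Decidable (λ e → e ∈ K × ¬ ((F ⊔ e) ∈ₗ I))
      survives? I e = e ∈? K ×-dec ¬? ((F ⊔ e) ∈ₗ? I)

      describes-delete : ∀ I → Describes F (separate (survives? I)) (deleteGEL V r (gel P G) I F)
      describes-delete I = describes-⟨∣⟩ P-bottom
        (λ e∈ → disjoint (proj₁ (sep⁻ e∈)))
        -- Whether `e` survives depends on `F ⊔ e` alone, so parallel elements survive together.
        (λ e∉F f∈ eq → let f∈K , f∉I = sep⁻ f∈ in
          sep⁺ (saturated e∉F f∈K eq , subst (λ x → ¬ (x ∈ₗ I)) (sym eq) f∉I))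
        (λ e∈ → G⊆P (from (gen _) (_ , proj₁ (sep⁻ e∈) , refl)))
        (λ g → mk⇔
          (λ (Gg , g∉I) → let e , e∈K , g≡ = to (gen g) Gg in
            e , sep⁺ (e∈K , subst (λ x → ¬ (x ∈ₗ I)) g≡ g∉I) , g≡)
          (λ { (e , e∈ , refl) → let e∈K , e∉I = sep⁻ e∈ in
            from (gen _) (e , e∈K , refl) , e∉I }))
        where
        sep⁺ = ∈-separate⁺ (survives? I)
        sep⁻ = ∈-separate⁻ (survives? I)

      -- Removing `i` from `K` need not leave a saturated set: an element outside `K` can become
      -- parallel over `i` to an element of `K`. All such elements are therefore included.
      parallelTo? : ∀ i → Decidable (λ e → e ∉ i × ∃ λ f → f ∈ K × i ⊔ e ≡ i ⊔ f)
      parallelTo? i e =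
        ¬? (e ∈? i) ×-dec any? (λ f → f ∈? K ×-dec Vec-≡-dec _≟ᵇ_ (i ⊔ e) (i ⊔ f))

      describes-contract : ∀ {i} → P i →
        Describes i (separate (parallelTo? i)) (contractGEL V r (gel P G) i)
      describes-contract {i} Pi = describes-⟨∣⟩ Pi
        (λ e∈ → proj₁ (sep⁻ e∈))
        (λ e∉i f∈ eq → let _ , h , h∈K , eq′ = sep⁻ f∈ in
          sep⁺ (e∉i , h , h∈K , trans eq eq′))
        (λ e∈ → let _ , f , f∈K , eq = sep⁻ e∈ in
          subst P (sym eq) (proj₁ (join₂-⊔ Pi f∈K)))
        (λ x → mk⇔ ⇒ ⇐)
        where
        sep⁺ = ∈-separate⁺ (parallelTo? i)
        sep⁻ = ∈-separate⁻ (parallelTo? i)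

        ⇒ : ∀ {x} → GEL.Gen (contractGEL V r (gel P G) i) x →
            ∃ λ e → e ∈ separate (parallelTo? i) × x ≡ i ⊔ e
        ⇒ {x} ((g , Gg , join) , x≢i) with f , f∈K , refl ← to (gen g) Gg =
          f , sep⁺ (f∉i , f , f∈K , refl) , x≡i⊔f
          where
          x≡i⊔f = join-unique join (join₂-⊔ Pi f∈K)
          -- If `f` were in `i`, then `i ⊔ f` would be `i`, which a contraction excludes from its
          -- generators.
          f∉i : f ∉ i
          f∉i f∈i = x≢i (trans x≡i⊔f (⊆-antisym (⊔-least id f∈i (P-closed Pi)) (⊔-base f)))

        ⇐ : ∀ {x} → (∃ λ e → e ∈ separate (parallelTo? i) × x ≡ i ⊔ e) →
            GEL.Gen (contractGEL V r (gel P G) i) x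
        ⇐ (e , e∈ , refl) = let e∉i , f , f∈K , eq = sep⁻ e∈ in
            ( F ⊔ f , from (gen _) (f , f∈K , refl)
            , subst (IsJoinIn V r P _) (sym eq) (join₂-⊔ Pi f∈K))
          , λ i⊔e≡i → e∉i (subst (e ∈_) i⊔e≡i (⊔-elem i e))

    -- Loops, and the lattice of flats as a minor of itself

    loops : Subset n
    loops = cl Sub.⊥

    loops⊆ : ∀ {X} → Closed X → loops ⊆ X
    loops⊆ = cl-least ⊥⊆

    loop⇔ : ∀ {e} → e ∈ loops ⇔ (r ⁅ e ⁆ ≡ 0#)
    loop⇔ {e} = mk⇔
      (λ e∈ → trans (cong r (sym (∪-identityˡ ⁅ e ⁆))) (trans (sym (∈cl⁻ e∈)) empty))
      (λ re≡0 → ∈cl⁺ (trans empty (trans (sym re≡0) (cong r (sym (∪-identityˡ ⁅ e ⁆))))))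

    cl-singleton : ∀ e → cl ⁅ e ⁆ ≡ loops ⊔ e
    cl-singleton e = ⊆-antisym (cl-mono (q⊆p∪q loops ⁅ e ⁆))
      (⊔-least (cl-mono ⊥⊆) (cl-extensive (x∈⁅x⁆ e)) cl-closed)

    -- Every flat contains the loops, and `K` holds all other elements, so each flat is spanned by
    -- its own elements.
    describes-flats : Describes loops (∁ loops) (flatGEL V r)
    describes-flats = record
      { closed    = cl-closed
      ; disjoint  = x∈∁p⇒x∉p
      ; saturated = λ e∉ _ _ → x∉p⇒x∈∁p e∉
      ; lat       = λ x → mk⇔ (spanned ∘ to isFlat⇔) (from isFlat⇔ ∘ proj₁)
      ; gen       = λ g → mk⇔
          (λ (e , re≢0 , g-cl) → e , x∉p⇒x∈∁p (re≢0 ∘ to loop⇔)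
                               , trans (to isClosureOf⇔ g-cl) (cl-singleton e))
          (λ (e , e∈ , g≡) → e , x∈∁p⇒x∉p e∈ ∘ from loop⇔
                           , from isClosureOf⇔ (trans g≡ (sym (cl-singleton e))))
      }
      where
      spanned : ∀ {x} → Closed x → Spanned loops (∁ loops) x
      spanned {x} x-closed = x-closed , loops⊆ x-closed , ⊆-span
        where
        ⊆-span : x ⊆ cl (loops ∪ (x ∩ ∁ loops))
        ⊆-span {e} e∈x with e ∈? loops
        ... | yes e∈ = cl-extensive (p⊆p∪q _ e∈)
        ... | no  e∉ = cl-extensive (q⊆p∪q loops _ (x∈p∩q⁺ (e∈x , x∉p⇒x∈∁p e∉)))

    describe : ∀ {L} → IsMinor V r L → ∃ λ F → ∃ λ K → Describes F K L
    describe here = _ , _ , describes-flats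
    -- The bottom supplied with a deletion is known only as an empty join; uniqueness identifies it
    -- with `F`.
    describe (delete m I _ bot bot-join) with F , K , D ← describe m
      with refl ← bottom-unique D bot-join = _ , _ , describes-delete D I
    describe (contract m I _ i₀ (Pi₀ , _)) with F , K , D ← describe m =
      _ , _ , describes-contract D Pi₀

    -- `F` is the bottom. For `e` in `K`, the generator `F ⊔ e` equals `F ⊔ f` for some `f` in `K′`,
    -- and saturation of `K′` then contains `e`.
    describes-functional : ∀ {F K F′ K′ P G P′ G′} →
      Describes F K (gel P G) → Describes F′ K′ (gel P′ G′) →
      (∀ x → P x ⇔ P′ x) → (∀ x → G x ⇔ G′ x) → F ≡ F′ × K ≡ K′
    describes-functional {F} {K} {F′} {K′} D D′ P⇔ G⇔
      with refl ← ⊆-antisym (P-above D (from (P⇔ F′) (P-bottom D′)))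
                            (P-above D′ (to (P⇔ F) (P-bottom D)))
      = refl , ⊆-antisym (⊆-by D D′ (to ∘ G⇔)) (⊆-by D′ D (from ∘ G⇔))
      where
      ⊆-by : ∀ {K₁ K₂ P₁ G₁ P₂ G₂} →
             Describes F K₁ (gel P₁ G₁) → Describes F K₂ (gel P₂ G₂) →
             (∀ g → G₁ g → G₂ g) → K₁ ⊆ K₂
      ⊆-by D₁ D₂ G⇒ {e} e∈ =
        let f , f∈ , eq = to (Describes.gen D₂ _)
                            (G⇒ _ (from (Describes.gen D₁ _) (e , e∈ , refl)))
        in Describes.saturated D₂ (Describes.disjoint D₁ e∈) f∈ eq

    describes-injective : ∀ {F K P G P′ G′} →
      Describes F K (gel P G) → Describes F K (gel P′ G′) →
      (∀ x → P x ⇔ P′ x) × (∀ x → G x ⇔ G′ x)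
    describes-injective D D′ =
        (λ x → ⇔.trans (Describes.lat D x) (⇔.sym (Describes.lat D′ x)))
      , (λ x → ⇔.trans (Describes.gen D x) (⇔.sym (Describes.gen D′ x)))

    -- Parallel closed pairs

    open ParallelClosedPair using (ground)

    -- A pair records the deleted set `Z`; this shows that `∁ F ∩ ∁ K` is the choice of `Z` with
    -- ground set `K`.
    relative-complement : ∀ {F K : Subset n} → (∀ {e} → e ∈ K → e ∉ F) →
                          ∁ F ∩ ∁ (∁ F ∩ ∁ K) ≡ K
    relative-complement {F} {K} disj = ⊆-antisym ⊆K K⊆
      where
      ⊆K : ∁ F ∩ ∁ (∁ F ∩ ∁ K) ⊆ K
      ⊆K {e} e∈ with e ∈? K
      ... | yes e∈K = e∈K
      ... | no  e∉K = let e∈∁F , e∈∁Z = x∈p∩q⁻ (∁ F) _ e∈ in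
        contradiction (x∈p∩q⁺ (e∈∁F , x∉p⇒x∈∁p e∉K)) (x∈∁p⇒x∉p e∈∁Z)
      K⊆ : K ⊆ ∁ F ∩ ∁ (∁ F ∩ ∁ K)
      K⊆ e∈K = x∈p∩q⁺ (x∉p⇒x∈∁p (disj e∈K) , x∉p⇒x∈∁p (λ e∈Z →
        x∈∁p⇒x∉p (proj₂ (x∈p∩q⁻ (∁ F) (∁ K) e∈Z)) e∈K))

    module _ {F K L} (D : Describes F K L) where

      open Describes D

      pair : ParallelClosedPair V r
      pair = record
        { F      = F
        ; flat   = from isFlat⇔ closed
        ; Z      = ∁ F ∩ ∁ K
        ; Z⊆E∖F  = p∩q⊆p (∁ F) (∁ K)
        ; closed = λ e f e∉F f∈ par → subst (e ∈_) (sym (relative-complement disjoint))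
            (saturated e∉F (subst (f ∈_) (relative-complement disjoint) f∈) (to parallel⇔ par))
        }

      ground-pair : ground pair ≡ K
      ground-pair = relative-complement disjoint

    -- The value of s is determined by F.
    ≈P-intro : ∀ {p q : ParallelClosedPair V r} →
      ParallelClosedPair.F p ≡ ParallelClosedPair.F q → ground p ≡ ground q → _≈P_ V r p q
    ≈P-intro F≡ ground≡ = F≡ , ground≡ , λ X _ → cong (λ F → contr V r F X) F≡

    -- The pair is read off a derivation of the minor; `toPair-cong` shows that it depends only on
    -- the resulting lattice and generators.
    toPair : Minor V r → ParallelClosedPair V r
    toPair M = pair (proj₂ (proj₂ (describe (Minor.isMinor M))))

    toPair-cong : ∀ {M N} → _≈M_ V r M N → _≈P_ V r (toPair M) (toPair N)
    toPair-cong {minor (gel _ _) m} {minor (gel _ _) m′} (P⇔ , G⇔)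
      with F , K , D ← describe m | F′ , K′ , D′ ← describe m′
      with refl , refl ← describes-functional D D′ P⇔ G⇔
      = ≈P-intro {pair D} {pair D′} refl refl

    toPair-injective : ∀ {M N} → _≈P_ V r (toPair M) (toPair N) → _≈M_ V r M N
    toPair-injective {minor (gel _ _) m} {minor (gel _ _) m′} (F≡ , ground≡ , _)
      with F , K , D ← describe m | F′ , K′ , D′ ← describe m′
      with refl ← F≡ | refl ← trans (sym (ground-pair D)) (trans ground≡ (ground-pair D′))
      = describes-injective D D′

    -- Serves surjectivity: since descriptions are unique, it suffices to find a minor that `p`
    -- describes.
    toPair-described : ∀ {p P G} → Describes (ParallelClosedPair.F p) (ground p) (gel P G) →
      ∀ {M} → (∀ x → GEL.Lat (Minor.lat M) x ⇔ P x) × (∀ x → GEL.Gen (Minor.lat M) x ⇔ G x) →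
      _≈P_ V r (toPair M) p
    toPair-described {p} D′ {minor (gel _ _) m} (P⇔ , G⇔) with F , K , D ← describe m
      with refl , refl ← describes-functional D D′ P⇔ G⇔
      = ≈P-intro {pair D} {p} refl (ground-pair D)

    -- A minor for each parallel closed pair

    module _ (p : ParallelClosedPair V r) where

      open ParallelClosedPair p renaming (ground to groundₚ)

      private
        F-closed : Closed F
        F-closed = to isFlat⇔ flat

      nonloops : Subset n
      nonloops = F ∩ ∁ loops

      points : List (Subset n)
      points = map (λ e → cl ⁅ e ⁆) (elements nonloops)

      points-gen : All (GEL.Gen (flatGEL V r)) points
      points-gen = All.map⁺ (All.tabulate λ {e} e∈ →
        e , x∈∁p⇒x∉p (proj₂ (x∈p∩q⁻ F (∁ loops) (∈-elements⁻ e∈))) ∘ from loop⇔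
          , from isClosureOf⇔ refl)

      -- Each nonloop of `F` lies in its own point, and loops lie in every flat, so an upper bound
      -- of the points contains `F`.
      points-join : IsJoinIn V r (IsFlat V r) points F
      points-join = flat
        , All.map⁺ (All.tabulate λ e∈ →
            cl-least (singleton⊆ (proj₁ (x∈p∩q⁻ F (∁ loops) (∈-elements⁻ e∈)))) F-closed)
        , least
        where
        least : ∀ y → IsFlat V r y → All (_⊆ y) points → F ⊆ y
        least y y-flat points⊆y {e} e∈F with e ∈? loops
        ... | yes e∈ = loops⊆ (to isFlat⇔ y-flat) e∈
        ... | no  e∉ = All.lookup points⊆y
          (∈-map⁺ (λ e → cl ⁅ e ⁆) (∈-elements⁺ (x∈p∩q⁺ (e∈F , x∉p⇒x∈∁p e∉))))
          (cl-extensive (x∈⁅x⁆ e))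

      contracted : GEL V r
      contracted = contractGEL V r (flatGEL V r) F

      contracted-minor : IsMinor V r contracted
      contracted-minor = contract here points points-gen F points-join

      describes-contracted : Describes F (separate (parallelTo? describes-flats F)) contracted
      describes-contracted = describes-contract describes-flats (from isFlat⇔ F-closed)

      -- Contracting the full lattice loses no element outside `F`: such an element is a nonloop and
      -- is parallel to itself.
      outside : ∀ {e} → e ∉ F → e ∈ separate (parallelTo? describes-flats F)
      outside {e} e∉F = ∈-separate⁺ (parallelTo? describes-flats F)
        (e∉F , e , x∉p⇒x∈∁p (λ e∈ → e∉F (loops⊆ F-closed e∈)) , refl)

      deleted : List (Subset n)
      deleted = map (F ⊔_) (elements Z)

      deleted-gen : All (GEL.Gen contracted) deleted
      deleted-gen = All.map⁺ (All.tabulate λ {e} e∈ →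
        from (Describes.gen describes-contracted _)
          (e , outside (x∈∁p⇒x∉p (Z⊆E∖F (∈-elements⁻ e∈))) , refl))

      fromPair : Minor V r
      fromPair = minor (deleteGEL V r contracted deleted F)
        (delete contracted-minor deleted deleted-gen F (bottom-join describes-contracted))

      -- Deleting `F ⊔ f` for `f` in `Z` also removes every element parallel to `f`. Closedness of
      -- the pair keeps these out of the ground set, so exactly `Z` is lost.
      survivors≡ground :
        separate (survives? describes-contracted deleted) ≡ groundₚ
      survivors≡ground = ⊆-antisym ⇒ ⇐
        where
        K? = survives? describes-contracted deleted

        ⇒ : separate K? ⊆ groundₚ
        ⇒ e∈ = let e∈K , e∉deleted = ∈-separate⁻ K? e∈ in
          x∈p∩q⁺ ( x∉p⇒x∈∁p (Describes.disjoint describes-contracted e∈K)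
                 , x∉p⇒x∈∁p (λ e∈Z → e∉deleted (∈-map⁺ (F ⊔_) (∈-elements⁺ e∈Z))))

        ⇐ : groundₚ ⊆ separate K?
        ⇐ {e} e∈ = ∈-separate⁺ K?
          (outside (x∈∁p⇒x∉p (proj₁ (x∈p∩q⁻ (∁ F) (∁ Z) e∈))) , λ e∈deleted →
            let f , f∈ , eq = ∈-map⁻ (F ⊔_) e∈deleted
                f∈Z         = ∈-elements⁻ f∈
                f∈ground    = closed f e (x∈∁p⇒x∉p (Z⊆E∖F f∈Z)) e∈ (from parallel⇔ (sym eq))
            in x∈∁p⇒x∉p (proj₂ (x∈p∩q⁻ (∁ F) (∁ Z) f∈ground)) f∈Z)

      describes-fromPair : Describes F groundₚ (Minor.lat fromPair)
      describes-fromPair = subst (λ K → Describes F K (Minor.lat fromPair)) survivors≡ground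
        (describes-delete describes-contracted deleted)

      toPair-fromPair : ∀ {M} → _≈M_ V r M fromPair → _≈P_ V r (toPair M) p
      toPair-fromPair {M} = toPair-described {p} describes-fromPair {M}

mainTheorem11 : (V : OrderedAbGroup) (n : ℕ)
    (r : Subset n → OrderedAbGroup.Carrier V) →
    IsPolymatroid V r →
    Bijection (MinorSetoid V r) (PairSetoid V r)
mainTheorem11 V n r poly = record
  { to        = toPair V r poly
  ; cong      = λ {M} {N} → toPair-cong V r poly {M} {N}
  ; bijective = (λ {M} {N} → toPair-injective V r poly {M} {N})
              , λ p → fromPair V r poly p , λ {M} → toPair-fromPair V r poly p {M}
  }
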